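{- For every $n$-HCFP $\mathcal{H}$ and every formula $\varphi$ of the logic $\mathsf{E(U,X)}$ with regular atomic predicates, the set of $n$-stores satisfying $\varphi$ in $\mathcal{H}$ is regular and effectively computable (as a finite automaton) from $\mathcal{H}$ and $\varphi$.
   Context: Higher-order stores over a finite alphabet $\Gamma$: a 1-store is a sequence $[a_1\ldots a_l]$, $a_i\in\Gamma$, $l\ge0$; for $n\ge2$ an $n$-store is a nonempty sequence $[s_1\ldots s_l]$ of $(n-1)$-stores. An $n$-store is identified with its word $w(s)=[w(s_1)\ldots w(s_l)]$ over $\Gamma'=\Gamma\cup\{[,]\}$; a set of $n$-stores is regular if its set of words is accepted by a finite automaton over $\Gamma'$. Operations: on 1-stores, $\mathit{push}_1^w([a_1\ldots a_l])=[w a_2\ldots a_l]$ for $w\in\Gamma^*$ and $\mathit{top}_1([a_1\ldots a_l])=a_1$ (defined only when $l\ge1$). On $n$-stores $s=[s_1\ldots s_l]$, $n>1$: $\mathit{push}_1^w(s)=[\mathit{push}_1^w(s_1)\,s_2\ldots s_l]$; for $2\le k<n$, $\mathit{push}_k(s)=[\mathit{push}_k(s_1)\,s_2\ldots s_l]$ and $\mathit{pop}_k(s)=[\mathit{pop}_k(s_1)\,s_2\ldots s_l]$; $\mathit{push}_n(s)=[s_1 s_1 s_2\ldots s_l]$; $\mathit{pop}_n(s)=[s_2\ldots s_l]$ if $l>1$, undefined otherwise; $\mathit{top}_k(s)=\mathit{top}_k(s_1)$ for $k<n$, $\mathit{top}_n(s)=s_1$. $O_n=\{\mathit{push}_k,\mathit{pop}_k\mid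 k\in[2,n]\}\cup\{\mathit{push}_1^w\mid w\in\Gamma^*\}$. An $n$-HCFP is $\mathcal{H}=(\Gamma,\Delta)$ with $\Delta\subseteq\Gamma\times O_n$ finite; configurations are $n$-stores, and $s\hookrightarrow s'$ iff there is $(a,o)\in\Delta$ with $\mathit{top}_1(s)=a$ and $s'=o(s)$ (defined). $\mathsf{E(U,X)}$ formulas: $\varphi::=R\mid\neg\varphi\mid\varphi\wedge\varphi\mid \mathsf{EX}\,\varphi\mid\mathsf{E}[\varphi\,\mathsf{U}\,\varphi]$, where $R$ ranges over regular sets of $n$-stores (given by finite automata). Semantics at a store $s$: $s\models R$ iff $s\in R$; Boolean connectives as usual; $s\models\mathsf{EX}\,\varphi$ iff there is $s'$ with $s\hookrightarrow s'$ and $s'\models\varphi$; $s\models\mathsf{E}[\varphi_1\mathsf{U}\varphi_2]$ iff there exist $m\ge0$ and stores $s=s_0\hookrightarrow s_1\hookrightarrow\cdots\hookrightarrow s_m$ with $s_m\models\varphi_2$ and $s_i\models\varphi_1$ for all $i<m$. -}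

module Defs where

open import Data.Fin.Base using (Fin; zero; suc; inject₁; fromℕ)
open import Data.Fin.Subset using (Subset; _∈_)
open import Data.List.Base as List using (List; []; _∷_; _++_; _∷ʳ_; concatMap)
open import Data.List.Membership.Propositional using () renaming (_∈_ to _∈ˡ_)
open import Data.List.NonEmpty.Base using (List⁺; _∷_; toList)
open import Data.Maybe.Base as Maybe using (Maybe; just; nothing)
open import Data.Nat.Base using (ℕ; suc; _≤_; s≤s; _≤′_; ≤′-reflexive; ≤′-refl; ≤′-step)
open import Data.Product.Base using (_×_; _,_; ∃-syntax; Σ-syntax)
open import Function.Bundles using (_⇔_)
open import Relation.Binary.PropositionalEquality.Core using (_≡_)
open import Relation.Nullary.Negation.Core using (¬_)

record NFA (A : Set) : Set where
  field
    size    : ℕ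
    initial : Subset size
    final   : Subset size
    δ       : Fin size → A → Subset size

  data AcceptsFrom (q : Fin size) : List A → Set where
    stop : q ∈ final → AcceptsFrom q []
    step : ∀ {q′ a w} → q′ ∈ δ q a → AcceptsFrom q′ w → AcceptsFrom q (a ∷ w)

  Accepts : List A → Set
  Accepts w = ∃[ q ] (q ∈ initial × AcceptsFrom q w)

-- The alphabet Γ is Fin γ throughout; lbr and rbr are the brackets [ and ].
data Letter (γ : ℕ) : Set where
  sym     : Fin γ → Letter γ
  lbr rbr : Letter γ

-- The head of the list is the top; there are no stores of order 0.
data Store (γ : ℕ) : ℕ → Set where
  store₁ : List (Fin γ) → Store γ 1
  storeₙ : ∀ {n} → List⁺ (Store γ (suc n)) → Store γ (suc (suc n))

word : ∀ {γ n} → Store γ n → List (Letter γ)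
word (store₁ as) = lbr ∷ List.map sym as ∷ʳ rbr
word (storeₙ ss) = lbr ∷ concatMap word (toList ss) ∷ʳ rbr

Recognises : ∀ {γ n} → NFA (Letter γ) → (Store γ n → Set) → Set
Recognises A P = ∀ u → NFA.Accepts A u ⇔ (∃[ s ] (word s ≡ u × P s))

record RegularSet (γ n : ℕ) : Set where
  field
    automaton  : NFA (Letter γ)
    onlyStores : ∀ u → NFA.Accepts automaton u → Σ[ s ∈ Store γ n ] word s ≡ u

_∈ᴿ_ : ∀ {γ n} → Store γ n → RegularSet γ n → Set
s ∈ᴿ R = NFA.Accepts (RegularSet.automaton R) (word s)

data Op (γ n : ℕ) : Set where
  push₁    : List (Fin γ) → Op γ n
  push pop : ∀ {k} → 2 ≤ k → k ≤′ n → Op γ n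

top₁ : ∀ {γ n} → Store γ n → Maybe (Fin γ)
top₁ (store₁ [])      = nothing
top₁ (store₁ (a ∷ _)) = just a
top₁ (storeₙ (s ∷ _)) = top₁ s

rewriteTop : ∀ {γ n} → List (Fin γ) → Store γ n → Maybe (Store γ n)
rewriteTop w (store₁ [])       = nothing
rewriteTop w (store₁ (_ ∷ as)) = just (store₁ (w ++ as))
rewriteTop w (storeₙ (s ∷ ss)) = Maybe.map (λ s′ → storeₙ (s′ ∷ ss)) (rewriteTop w s)

-- Apply f to the topmost k-store: s itself if n = k, and top_{k+1}(s) if n > k.
atLevel : ∀ {γ k n} → k ≤′ n → (Store γ k → Maybe (Store γ k)) → Store γ n → Maybe (Store γ n)
atLevel ≤′-refl      f s                = f s
atLevel (≤′-step le) f (storeₙ (s ∷ ss)) = Maybe.map (λ s′ → storeₙ (s′ ∷ ss)) (atLevel le f s)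
-- Reached only if k = 0, when f has an empty domain.
atLevel (≤′-step _)  f (store₁ _)       = nothing

duplicateTop : ∀ {γ n} → Store γ (suc (suc n)) → Maybe (Store γ (suc (suc n)))
duplicateTop (storeₙ (s ∷ ss)) = just (storeₙ (s ∷ s ∷ ss))

removeTop : ∀ {γ n} → Store γ (suc (suc n)) → Maybe (Store γ (suc (suc n)))
removeTop (storeₙ (_ ∷ []))     = nothing
removeTop (storeₙ (_ ∷ s ∷ ss)) = just (storeₙ (s ∷ ss))

apply : ∀ {γ n} → Op γ n → Store γ n → Maybe (Store γ n)
apply (push₁ w)                = rewriteTop w
apply (push (s≤s (s≤s _)) k≤n) = atLevel k≤n duplicateTop
apply (pop  (s≤s (s≤s _)) k≤n) = atLevel k≤n removeTop

record HCFP (γ n : ℕ) : Set where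
  field
    Δ : List (Fin γ × Op γ n)

_⊢_↪_ : ∀ {γ n} → HCFP γ n → Store γ n → Store γ n → Set
H ⊢ s ↪ s′ = ∃[ a ] ∃[ o ] ((a , o) ∈ˡ HCFP.Δ H × top₁ s ≡ just a × apply o s ≡ just s′)

data Formula (γ n : ℕ) : Set where
  atom    : RegularSet γ n → Formula γ n
  neg     : Formula γ n → Formula γ n
  _and_   : Formula γ n → Formula γ n → Formula γ n
  EX      : Formula γ n → Formula γ n
  E[_U_]  : Formula γ n → Formula γ n → Formula γ n

infix 4 _,_⊨_

_,_⊨_ : ∀ {γ n} → HCFP γ n → Store γ n → Formula γ n → Set
H , s ⊨ atom R      = s ∈ᴿ R
H , s ⊨ neg φ       = ¬ (H , s ⊨ φ)
H , s ⊨ (φ and ψ)   = (H , s ⊨ φ) × (H , s ⊨ ψ)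
H , s ⊨ EX φ        = ∃[ s′ ] ((H ⊢ s ↪ s′) × (H , s′ ⊨ φ))
_,_⊨_ {γ} {n} H s E[ φ U ψ ] =
  Σ[ m ∈ ℕ ] Σ[ σ ∈ (Fin (suc m) → Store γ n) ]
    ( σ zero ≡ s
    × (∀ (i : Fin m) → H ⊢ σ (inject₁ i) ↪ σ (suc i))
    × (H , σ (fromℕ m) ⊨ ψ)
    × (∀ (i : Fin m) → H , σ (inject₁ i) ⊨ φ) )

{-# OPTIONS --safe #-}
module Submission where

-- Let letters be nested lists of order 0 and lists of nested lists of order n be those of order n + 1, allowing
-- empty lists at all orders. A system consists of a finite set of predicates on nested lists and of monotone
-- rules that derive predicates of s from predicates of the lists o s, for operations o; of s itself a rule sees
-- only the topmost letter, or else the order at which it is missing.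
--
-- The least model of a system of order n + 1 is found by induction on n. Writing Q for the set of predicates
-- true of r, that p holds of t ∷ r is a predicate (p , Q) of t, and these predicates are the least model of a
-- system of order n: for p to hold after an operation that replaces t by o₁ t, …, oₖ t there must be sets
-- V₁, …, Vₖ = Q such that (p , V₁) holds of o₁ t and (q , Vⱼ₊₁) holds of oⱼ₊₁ t for all q in Vⱼ. At order 0 the
-- least model is a least fixed point in a finite powerset. Thus the set of predicates true of s is the value of
-- s in a finite algebra, which an automaton computes by scanning the word of s from right to left.
--
-- The word of a store can be read destructively, by popping, so that acceptance by a given automaton from a
-- given state is itself a predicate of a system; EX and EU are then added as rules.

open import Defs
open import Data.Bool.Base using (Bool; true; false; if_then_else_)
open import Data.Fin.Base using (Fin; zero; suc; inject₁; fromℕ)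
open import Data.Fin.Properties using (any?; all?; _≟_; +↔⊎; *↔×; 1↔⊤; 2↔Bool)
open import Data.Fin.Subset using (Subset; _∈_; _⊆_; ∣_∣) renaming (⊥ to ∅)
open import Data.Fin.Subset.Properties using (_∈?_; ∉⊥; ∣p∣≤n; p⊂q⇒∣p∣<∣q∣)
open import Data.List.Base as List using (List; []; _∷_; _++_; _∷ʳ_; concatMap; length)
open import Data.List.Membership.Propositional using (find; lose)
open import Data.List.NonEmpty.Base using (_∷_)
open import Data.List.Properties using (++-assoc; ∷-injectiveˡ; ∷-injectiveʳ; map-id; length-++)
open import Data.List.Relation.Unary.All using (All; []; _∷_)
open import Data.List.Relation.Unary.Any as Any using (Any)
open import Data.Maybe.Base as Maybe using (Maybe; just; nothing)
open import Data.Maybe.Properties using (≡-dec; just-injective)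
open import Data.Nat.Base using (ℕ; zero; suc; _≤_; _<_; z≤n; s≤s; _≤′_; ≤′-refl; ≤′-reflexive; ≤′-step)
open import Data.Nat.Properties using (≤-refl; ≤-trans; ≤-pred; ≤-<-trans; <-irrefl; m≤n+m)
open import Data.Product.Base using (Σ-syntax; ∃; ∃-syntax; _×_; _,_; proj₁; proj₂; map₁; map₂)
open import Data.Product.Function.NonDependent.Propositional using (_×-↔_; _×-⇔_)
open import Data.Sum.Base using (_⊎_; inj₁; inj₂)
open import Data.Sum.Function.Propositional using (_⊎-↔_)
open import Data.Unit.Base using (⊤; tt)
open import Data.Vec.Base using ([]; _∷_; tabulate)
open import Data.Vec.Properties using ([]=⇒lookup; lookup⇒[]=; lookup∘tabulate)
open import Function.Base using (_∘_)
open import Function.Bundles using (_⇔_; _↔_; mk⇔; mk↔ₛ′; Inverse; Equivalence)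
open import Function.Properties.Inverse using (↔⇒↣; ↔-refl; ↔-sym; ↔-trans)
open import Relation.Binary.PropositionalEquality as ≡ using (_≡_; _≢_; refl; trans; cong; cong₂; subst)
open import Relation.Nullary using (Dec; yes; no; does; contradiction)
open import Relation.Nullary.Decidable using (map′; _×-dec_; _→-dec_; _⊎-dec_; dec-true; decidable-stable; ¬?)
open import Relation.Nullary.Decidable using (via-injection)

-- Finite types and least fixed points

Finite : Set → Set
Finite A = ∃[ n ] (A ↔ Fin n)

fin-finite : ∀ {n} → Finite (Fin n)
fin-finite = _ , ↔-refl

bool-finite : Finite Bool
bool-finite = _ , ↔-sym 2↔Bool

⊤-finite : Finite ⊤
⊤-finite = _ , ↔-sym 1↔⊤

infixr 1 _⊎-finite_
infixr 2 _×-finite_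

_⊎-finite_ : ∀ {A B} → Finite A → Finite B → Finite (A ⊎ B)
(_ , f) ⊎-finite (_ , g) = _ , ↔-trans (f ⊎-↔ g) (↔-sym +↔⊎)

_×-finite_ : ∀ {A B} → Finite A → Finite B → Finite (A × B)
(_ , f) ×-finite (_ , g) = _ , ↔-trans (f ×-↔ g) (↔-sym *↔×)

maybe-finite : ∀ {A} → Finite A → Finite (Maybe A)
maybe-finite {A} f = map₂ (↔-trans Maybe↔⊤⊎) (⊤-finite ⊎-finite f)
  where
  Maybe↔⊤⊎ : Maybe A ↔ (⊤ ⊎ A)
  Maybe↔⊤⊎ = mk↔ₛ′
    (λ { nothing → inj₁ tt ; (just a) → inj₂ a }) (λ { (inj₁ tt) → nothing ; (inj₂ a) → just a })
    (λ { (inj₁ tt) → refl ; (inj₂ a) → refl }) (λ { nothing → refl ; (just a) → refl })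

subset-finite : ∀ n → Finite (Subset n)
subset-finite zero    = map₂ (↔-trans (mk↔ₛ′ (λ _ → tt) (λ _ → []) (λ _ → refl) (λ { [] → refl }))) ⊤-finite
subset-finite (suc n) = map₂ (↔-trans (mk↔ₛ′
  (λ { (b ∷ p) → b , p }) (λ { (b , p) → b ∷ p }) (λ _ → refl) (λ { (_ ∷ _) → refl })))
  (bool-finite ×-finite subset-finite n)

module _ {A : Set} (fin : Finite A) where

  enc : A → Fin (proj₁ fin)
  enc = Inverse.to (proj₂ fin)

  dec : Fin (proj₁ fin) → A
  dec = Inverse.from (proj₂ fin)

  dec-enc : ∀ a → dec (enc a) ≡ a
  dec-enc = Inverse.strictlyInverseʳ (proj₂ fin)

  enc-dec : ∀ i → enc (dec i) ≡ i
  enc-dec = Inverse.strictlyInverseˡ (proj₂ fin)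

  any-finite? : {P : A → Set} → (∀ a → Dec (P a)) → Dec (∃ P)
  any-finite? {P} P? =
    map′ (λ (i , p) → dec i , p) (λ (a , p) → enc a , subst P (≡.sym (dec-enc a)) p) (any? (P? ∘ dec))

  all-finite? : {P : A → Set} → (∀ a → Dec (P a)) → Dec (∀ a → P a)
  all-finite? {P} P? = map′ (λ h a → subst P (dec-enc a) (h (enc a))) (_∘ dec) (all? (P? ∘ dec))

  ≟-finite : (a b : A) → Dec (a ≡ b)
  ≟-finite = via-injection (↔⇒↣ (proj₂ fin)) _≟_

  FiniteSubset : Set
  FiniteSubset = Subset (proj₁ fin)

  comprehension : {P : A → Set} → (∀ a → Dec (P a)) → FiniteSubset
  comprehension P? = tabulate (does ∘ P? ∘ dec)

infix 4 _∈⟨_⟩_ _∈⟨_⟩?_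

_∈⟨_⟩_ : ∀ {A} → A → (fin : Finite A) → FiniteSubset fin → Set
a ∈⟨ fin ⟩ S = enc fin a ∈ S

_∈⟨_⟩?_ : ∀ {A} (a : A) (fin : Finite A) (S : FiniteSubset fin) → Dec (a ∈⟨ fin ⟩ S)
a ∈⟨ fin ⟩? S = enc fin a ∈? S

module _ {A : Set} (fin : Finite A) {P : A → Set} (P? : ∀ a → Dec (P a)) where

  ∈-comprehension⁺ : ∀ {a} → P a → a ∈⟨ fin ⟩ comprehension fin P?
  ∈-comprehension⁺ {a} p = lookup⇒[]= (enc fin a) _
    (trans (lookup∘tabulate _ (enc fin a)) (dec-true (P? _) (subst P (≡.sym (dec-enc fin a)) p)))

  -- Stated for raw indices, because the states of an `NFA` are indices and not elements of `A`.
  ∈-comprehension-dec⁻ : ∀ i → i ∈ comprehension fin P? → P (dec fin i)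
  ∈-comprehension-dec⁻ i m
    with P? (dec fin i) | trans (≡.sym (lookup∘tabulate (does ∘ P? ∘ dec fin) i)) ([]=⇒lookup m)
  ... | yes p | _ = p
  ... | no _  | ()

  ∈-comprehension⁻ : ∀ {a} → a ∈⟨ fin ⟩ comprehension fin P? → P a
  ∈-comprehension⁻ {a} m = subst P (dec-enc fin a) (∈-comprehension-dec⁻ (enc fin a) m)

-- `Next` acts on arbitrary predicates, so that leastness can be tested against an undecidable `Z`;
-- `next?` keeps the iteration itself computable.
record Operator (A : Set) : Set₁ where
  field
    Next  : (A → Set) → A → Set
    mono  : ∀ {D E} → (∀ a → D a → E a) → ∀ {a} → Next D a → Next E a
    next? : ∀ {D} → (∀ a → Dec (D a)) → ∀ a → Dec (Next D a)

module _ {A : Set} (fin : Finite A) (G : Operator A) where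
  open Operator G

  stage : ℕ → FiniteSubset fin
  stage zero    = ∅
  stage (suc k) = comprehension fin (next? (_∈⟨ fin ⟩? stage k))

  stage-least : ∀ {Z : A → Set} → (∀ a → Next Z a → Z a) → ∀ k a → a ∈⟨ fin ⟩ stage k → Z a
  stage-least closed zero    a m = contradiction m ∉⊥
  stage-least closed (suc k) a m =
    closed a (mono (stage-least closed k) (∈-comprehension⁻ fin (next? _) m))

  stage-increasing : ∀ k a → a ∈⟨ fin ⟩ stage k → a ∈⟨ fin ⟩ stage (suc k)
  stage-increasing zero    a m = contradiction m ∉⊥
  stage-increasing (suc k) a m =
    ∈-comprehension⁺ fin (next? _) (mono (stage-increasing k) (∈-comprehension⁻ fin (next? _) m))

  Stable : ℕ → Set
  Stable k = ∀ a → a ∈⟨ fin ⟩ stage (suc k) → a ∈⟨ fin ⟩ stage k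

  -- A stage that is not stable gains an element at the next step, so without a stable stage the
  -- cardinality grows by at least one each time.
  stable⊎growing : ∀ k → ∃ Stable ⊎ k ≤ ∣ stage k ∣
  stable⊎growing zero    = inj₂ z≤n
  stable⊎growing (suc k) with stable⊎growing k
  ... | inj₁ s = inj₁ s
  ... | inj₂ k≤ with any-finite? fin (λ a → (a ∈⟨ fin ⟩? stage (suc k)) ×-dec ¬? (a ∈⟨ fin ⟩? stage k))
  ...   | yes (a , new , ¬old) = inj₂ (≤-<-trans k≤ (p⊂q⇒∣p∣<∣q∣ (stage-⊆ , enc fin a , new , ¬old)))
    where
    stage-⊆ : stage k ⊆ stage (suc k)
    stage-⊆ {i} m = subst (_∈ stage (suc k)) (enc-dec fin i)
      (stage-increasing k (dec fin i) (subst (_∈ stage k) (≡.sym (enc-dec fin i)) m))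
  ...   | no none = inj₁ (k , λ a new → decidable-stable (a ∈⟨ fin ⟩? stage k) (λ ¬old → none (a , new , ¬old)))

  stabilises : ∃ Stable
  -- One more than the number of elements of `A`: no subset is that large.
  stabilises with stable⊎growing (suc (proj₁ fin))
  ... | inj₁ s = s
  ... | inj₂ k≤ = contradiction (≤-trans k≤ (∣p∣≤n (stage (suc (proj₁ fin))))) (<-irrefl refl)

  lfp : FiniteSubset fin
  lfp = stage (proj₁ stabilises)

  lfp-closed : ∀ a → Next (_∈⟨ fin ⟩ lfp) a → a ∈⟨ fin ⟩ lfp
  lfp-closed a n = proj₂ stabilises a (∈-comprehension⁺ fin (next? _) n)

  lfp-least : ∀ {Z : A → Set} → (∀ a → Next Z a → Z a) → ∀ a → a ∈⟨ fin ⟩ lfp → Z a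
  lfp-least closed = stage-least closed (proj₁ stabilises)

-- Systems and their least models

Nested : ℕ → ℕ → Set
Nested γ zero    = Fin γ
Nested γ (suc n) = List (Nested γ n)

-- The first nested list codes an operation: a letter overwrites, and [o₁ … oₖ] replaces the top element t by
-- o₁ t, …, oₖ t, so that [] pops. Acting on an empty list is junk.
act : ∀ {γ} n → Nested γ n → Nested γ n → Nested γ n
act zero    b  a       = b
act (suc n) os []      = []
act (suc n) os (t ∷ r) = List.map (λ o → act n o t) os ++ r

Top : ℕ → ℕ → Set
Top γ zero    = Fin γ
Top γ (suc n) = Maybe (Top γ n)

top : ∀ {γ} n → Nested γ n → Top γ n
top zero    a       = a
top (suc n) []      = nothing
top (suc n) (t ∷ r) = just (top n t)

-- The hypothesis `D` of a rule is indexed by the codes `o` of operations, not by nested lists, so a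
-- rule is the same for all `s` with the same `Top`. `Closed` instantiates it at `act n o s`.
record System (γ n : ℕ) (P : Set) : Set₁ where
  field
    Rule  : Top γ n → (Nested γ n → P → Set) → P → Set
    mono  : ∀ {i D E} → (∀ o p → D o p → E o p) → ∀ {p} → Rule i D p → Rule i E p
    rule? : ∀ {i D} → (∀ o p → Dec (D o p)) → ∀ p → Dec (Rule i D p)

Closed : ∀ {γ n P} → System γ n P → (Nested γ n → P → Set) → Set
Closed {n = n} S Z = ∀ s p → System.Rule S (top n s) (λ o → Z (act n o s)) p → Z s p

module _ {P : Set} (fin : Finite P) where

  fin′ : Finite (P × FiniteSubset fin)
  fin′ = fin ×-finite subset-finite _

  -- A derivation of `q` for `o₁ t ∷ … ∷ oₖ t ∷ r` that knows only `Q` of `r`. `V` is a guess of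
  -- what is needed of the list after the first element; each `q′` in `V` may make its own further
  -- guesses.
  Chain : ∀ {O : Set} → (O → P × FiniteSubset fin → Set) → FiniteSubset fin → List O → P → Set
  Chain D Q []       q = q ∈⟨ fin ⟩ Q
  Chain D Q (o ∷ os) q = ∃[ V ] (D o (q , V) × (∀ q′ → q′ ∈⟨ fin ⟩ V → Chain D Q os q′))

  chain-mono : ∀ {O D E} → (∀ (o : O) p → D o p → E o p) → ∀ {Q} os q → Chain D Q os q → Chain E Q os q
  chain-mono D⊆E []       q m           = m
  chain-mono D⊆E (o ∷ os) q (V , d , h) = V , D⊆E o _ d , λ q′ m → chain-mono D⊆E os q′ (h q′ m)

  chain? : ∀ {O D} → (∀ (o : O) p → Dec (D o p)) → ∀ {Q} os q → Dec (Chain D Q os q)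
  chain? D? {Q} []       q = q ∈⟨ fin ⟩? Q
  chain? D?     (o ∷ os) q = any-finite? (subset-finite _) λ V →
    D? o (q , V) ×-dec all-finite? fin (λ q′ → (q′ ∈⟨ fin ⟩? V) →-dec chain? D? os q′)

  consTruth? : (T : FiniteSubset fin′) (Q : FiniteSubset fin) (p : P) → Dec ((p , Q) ∈⟨ fin′ ⟩ T)
  consTruth? T Q p = (p , Q) ∈⟨ fin′ ⟩? T

module _ {γ : ℕ} {P : Set} (fin : Finite P) where

  letterOperator : System γ zero P → Operator (Fin γ × P)
  letterOperator S = record
    { Next  = λ D (a , p) → Rule a (λ b q → D (b , q)) p
    ; mono  = λ D⊆E → mono (λ b q → D⊆E (b , q))
    ; next? = λ D? (a , p) → rule? (λ b q → D? (b , q)) p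
    } where open System S

  emptyOperator : ∀ {n} → System γ (suc n) P → Operator P
  emptyOperator S = record
    { Next  = λ D → Rule nothing (λ _ → D)
    ; mono  = λ D⊆E → mono (λ _ → D⊆E)
    ; next? = λ D? → rule? (λ _ → D?)
    } where open System S

  -- (p , Q) says of t that p holds of t ∷ r whenever all of Q holds of r.
  lower : ∀ {n} → System γ (suc n) P → System γ n (P × FiniteSubset fin)
  lower S = record
    { Rule  = λ { i D (p , Q) → Rule (just i) (Chain fin D Q) p }
    ; mono  = λ D⊆E → mono (chain-mono fin D⊆E)
    ; rule? = λ { D? (p , Q) → rule? (chain? fin D?) p }
    } where open System S

-- Lists are evaluated by a right fold. Finiteness of the type `W` of element values is recorded
-- because the automaton's states contain unfinished evaluations of elements.
data Algebra (γ : ℕ) : ℕ → Set → Set₁ where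
  leaf : ∀ {V} → (Fin γ → V) → Algebra γ zero V
  node : ∀ {n V W} → Finite W → Algebra γ n W → V → (W → V → V) → Algebra γ (suc n) V

eval : ∀ {γ n V} → Algebra γ n V → Nested γ n → V
eval (leaf f)              a = f a
eval (node _ A empty cons) s = List.foldr (λ t → cons (eval A t)) empty s

module _ {γ : ℕ} {P : Set} (fin : Finite P) where

  letterTruth? : (S : System γ zero P) (a : Fin γ) (p : P) →
    Dec ((a , p) ∈⟨ fin-finite ×-finite fin ⟩ lfp (fin-finite ×-finite fin) (letterOperator fin S))
  letterTruth? S a p = (a , p) ∈⟨ fin-finite ×-finite fin ⟩? lfp _ (letterOperator fin S)

opaque

  -- Overwriting changes the letter, so at order 0 one fixed point covers all pairs of a letter and
  -- a predicate. At higher orders only `[]` needs a fixed point of its own, as `act` fixes it; a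
  -- nonempty list is left to the lowered system.
  truth : ∀ {γ n P} (fin : Finite P) → System γ n P → Algebra γ n (FiniteSubset fin)
  truth {n = zero} fin S = leaf λ a → comprehension fin (letterTruth? fin S a)
  truth {n = suc n} fin S = node (subset-finite _) (truth (fin′ fin) (lower fin S)) (lfp fin (emptyOperator fin S))
    λ T Q → comprehension fin (consTruth? fin T Q)

Holds : ∀ {γ n P} (fin : Finite P) → System γ n P → Nested γ n → P → Set
Holds fin S s p = p ∈⟨ fin ⟩ eval (truth fin S) s

opaque
  unfolding truth

  holds-closed : ∀ {γ} n {P} (fin : Finite P) (S : System γ n P) → Closed S (Holds fin S)
  holds-closed zero fin S a p r = ∈-comprehension⁺ fin (letterTruth? fin S a)
    (lfp-closed _ (letterOperator fin S) (a , p) (mono (λ b q → ∈-comprehension⁻ fin (letterTruth? fin S b)) r))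
    where open System S
  holds-closed (suc n) fin S [] p r = lfp-closed fin (emptyOperator fin S) p r
  -- The lowered system is applied to `t` with `Q` the exact set of truths about `r`.
  holds-closed (suc n) fin S (t ∷ r) p ρ =
    ∈-comprehension⁺ fin (consTruth? fin _ _) (holds-closed n (fin′ fin) (lower fin S) t (p , Q) (mono chain ρ))
    where
    open System S
    Q : FiniteSubset fin
    Q = eval (truth fin S) r
    chain : ∀ os q → Holds fin S (List.map (λ o → act n o t) os ++ r) q →
      Chain fin (λ o → Holds (fin′ fin) (lower fin S) (act n o t)) Q os q
    chain []       q h = h
    -- The guess is the value of the rest of the list, whose members hold of that rest by
    -- definition.
    chain (o ∷ os) q h = _ , ∈-comprehension⁻ fin (consTruth? fin _ _) h , chain os

  holds-least : ∀ {γ} n {P} (fin : Finite P) (S : System γ n P) {Z : Nested γ n → P → Set} → Closed S Z →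
    ∀ s p → Holds fin S s p → Z s p
  holds-least zero fin S {Z} closed a p h =
    lfp-least _ (letterOperator fin S) {λ (a , p) → Z a p} (λ (a , p) → closed a p) (a , p)
      (∈-comprehension⁻ fin (letterTruth? fin S a) h)
  holds-least (suc n) fin S closed [] p h = lfp-least fin (emptyOperator fin S) (closed []) p h
  holds-least {γ} (suc n) {P} fin S {Z} closed (t ∷ r) p h =
    holds-least n (fin′ fin) (lower fin S) {Z′} closed′ t (p , _)
      (∈-comprehension⁻ fin (consTruth? fin _ _) h) r (holds-least (suc n) fin S closed r)
    where
    open System S
    Z′ : Nested γ n → P × FiniteSubset fin → Set
    -- Quantifying over all `r` makes `Z′` closed although the lowered system knows nothing of `r`.
    -- The actual tail is supplied at the end, by recursion on the list.
    Z′ t (p , Q) = ∀ r → (∀ q → q ∈⟨ fin ⟩ Q → Z r q) → Z (t ∷ r) p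
    unchain : ∀ {t Q r} → (∀ q → q ∈⟨ fin ⟩ Q → Z r q) →
      ∀ os q → Chain fin (λ o → Z′ (act n o t)) Q os q → Z (List.map (λ o → act n o t) os ++ r) q
    unchain Q⊆Z []       q m           = Q⊆Z q m
    unchain Q⊆Z (o ∷ os) q (V , z , h) = z _ (λ q′ m → unchain Q⊆Z os q′ (h q′ m))
    closed′ : Closed (lower fin S) Z′
    closed′ t (p , Q) ρ r Q⊆Z = closed (t ∷ r) p (mono (unchain Q⊆Z) ρ)

-- Evaluating a finite algebra by an automaton

spell  : ∀ {γ} n → Nested γ n → List (Letter γ)
spells : ∀ {γ} n → List (Nested γ n) → List (Letter γ)

spell zero    a = sym a ∷ []
spell (suc n) s = lbr ∷ spells n s

spells n []      = rbr ∷ []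
spells n (t ∷ r) = spell n t ++ spells n r

-- The argument is the order of the elements of the list.
mayBeEmpty : ℕ → Bool
mayBeEmpty zero    = true
mayBeEmpty (suc _) = false

admissible : ∀ {A : Set} → ℕ → List A → Bool
admissible n []      = mayBeEmpty n
admissible n (_ ∷ _) = true

-- At positive orders these are the images of stores: only a 1-store may be empty.
Proper : ∀ {γ} n → Nested γ n → Set
Proper zero    a = ⊤
Proper (suc n) s = admissible n s ≡ true × All (Proper n) s

-- Words are scanned from right to left. In (v , b , x), v is the value of the list of the elements
-- already scanned, b says whether this list is admissible, and x is the state inside the next element.
Scan : ∀ {γ n V} → Algebra γ n V → Set
Scan (leaf _)               = ⊤
Scan (node {V = V} _ A _ _) = Maybe (V × Bool × Maybe (Scan A))

start : ∀ {γ n V} (A : Algebra γ n V) → Scan A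
start (leaf _)       = tt
start (node _ _ _ _) = nothing

resume : ∀ {V W S : Set} → (W → V → V) → V → Bool → W ⊎ S → V ⊎ Maybe (V × Bool × Maybe S)
resume cons v b (inj₁ w) = inj₂ (just (cons w v , true , nothing))
resume cons v b (inj₂ x) = inj₂ (just (v , b , just x))

-- The result `nothing` rejects; `inj₁` delivers the value once the first letter of the word has
-- been reached.
scan : ∀ {γ n V} (A : Algebra γ n V) → Letter γ → Scan A → Maybe (V ⊎ Scan A)
scan (leaf f) (sym a) _ = just (inj₁ (f a))
scan (leaf f) lbr     _ = nothing
scan (leaf f) rbr     _ = nothing
scan {n = suc n} (node _ A empty cons) rbr nothing = just (inj₂ (just (empty , mayBeEmpty n , nothing)))
scan (node _ A empty cons) lbr     nothing = nothing
scan (node _ A empty cons) (sym _) nothing = nothing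
-- Between elements, an opening bracket met from the right can only end the list itself.
scan (node _ A empty cons) lbr     (just (v , b , nothing)) = if b then just (inj₁ v) else nothing
scan (node _ A empty cons) rbr     (just (v , b , nothing)) = Maybe.map (resume cons v b) (scan A rbr (start A))
scan (node _ A empty cons) (sym a) (just (v , b , nothing)) =
  Maybe.map (resume cons v b) (scan A (sym a) (start A))
scan (node _ A empty cons) l       (just (v , b , just x))  = Maybe.map (resume cons v b) (scan A l x)

-- The invariant of the scan: what a state asserts about the letters `u` read so far, namely
-- finished elements `r` preceded by a suffix `w` of the next one.
Partial  : ∀ {γ n V} (A : Algebra γ n V) → Scan A → List (Letter γ) → Set
Partial? : ∀ {γ n V} (A : Algebra γ n V) → Maybe (Scan A) → List (Letter γ) → Set

Partial (leaf _)       _       u = u ≡ []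
Partial (node _ _ _ _) nothing u = u ≡ []
Partial {n = suc n} B@(node _ A _ _) (just (v , b , x)) u =
  ∃[ r ] (All (Proper n) r × admissible n r ≡ b × eval B r ≡ v × ∃[ w ] (u ≡ w ++ spells n r × Partial? A x w))

Partial? A nothing  w = w ≡ []
Partial? A (just x) w = Partial A x w

Scanned : ∀ {γ n V} (A : Algebra γ n V) → V ⊎ Scan A → List (Letter γ) → Set
Scanned {n = n} A (inj₁ v) u = ∃[ s ] (Proper n s × eval A s ≡ v × spell n s ≡ u)
Scanned         A (inj₂ x) u = Partial A x u

partial-start : ∀ {γ n V} (A : Algebra γ n V) → Partial A (start A) []
partial-start (leaf _)       = refl
partial-start (node _ _ _ _) = refl

scan-sound : ∀ {γ n V} (A : Algebra γ n V) l x z u → scan A l x ≡ just z → Partial A x u → Scanned A z (l ∷ u)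

-- The common case of a letter that belongs to an element. The result of the inner scan is
-- abstracted as `y`, so that one match tells whether the element is finished.
resume-sound : ∀ {γ n V W} (fin : Finite W) (A : Algebra γ n W) (empty : V) cons l x y z {r w} →
  All (Proper n) r → scan A l x ≡ y → Partial A x w →
  Maybe.map (resume cons (eval (node fin A empty cons) r) (admissible n r)) y ≡ just z →
  Scanned (node fin A empty cons) z (l ∷ w ++ spells n r)
resume-sound {n = n} fin A empty cons l x (just y@(inj₁ _)) _ {r} ps e p refl with scan-sound A l x y _ e p
... | t , pt , refl , eq = _ , pt ∷ ps , refl , refl , [] , cong (_++ spells n r) (≡.sym eq) , refl
resume-sound fin A empty cons l x (just y@(inj₂ x′)) _ ps e p refl =
  _ , ps , refl , refl , _ , refl , scan-sound A l x y _ e p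

scan-sound (leaf f) (sym a) x _ _ refl refl = a , tt , refl , refl
scan-sound (node _ A empty cons) rbr nothing _ _ refl refl = [] , [] , refl , refl , [] , refl , refl
scan-sound (node _ A empty cons) lbr (just (v , b , nothing)) _ _ e (r , ps , ad , ev , _ , refl , refl)
  with b | e
... | true  | refl = r , (ad , ps) , ev , refl
... | false | ()
scan-sound (node fin A empty cons) rbr (just (_ , _ , nothing)) z _ e (r , ps , refl , refl , _ , refl , refl) =
  resume-sound fin A empty cons rbr (start A) _ z ps refl (partial-start A) e
scan-sound (node fin A empty cons) (sym a) (just (_ , _ , nothing)) z _ e
  (r , ps , refl , refl , _ , refl , refl) =
  resume-sound fin A empty cons (sym a) (start A) _ z ps refl (partial-start A) e
scan-sound (node fin A empty cons) lbr (just (_ , _ , just x)) z _ e (r , ps , refl , refl , w , refl , p) =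
  resume-sound fin A empty cons lbr x _ z ps refl p e
scan-sound (node fin A empty cons) rbr (just (_ , _ , just x)) z _ e (r , ps , refl , refl , w , refl , p) =
  resume-sound fin A empty cons rbr x _ z ps refl p e
scan-sound (node fin A empty cons) (sym a) (just (_ , _ , just x)) z _ e (r , ps , refl , refl , w , refl , p) =
  resume-sound fin A empty cons (sym a) x _ z ps refl p e

-- The word is consumed from its end: the head `l` is the letter scanned last.
data Scans {γ n V} (A : Algebra γ n V) (x : Scan A) : List (Letter γ) → V ⊎ Scan A → Set where
  []  : Scans A x [] (inj₂ x)
  _∷_ : ∀ {l w y z} → scan A l y ≡ just z → Scans A x w (inj₂ y) → Scans A x (l ∷ w) z

scans-trans : ∀ {γ n V} (A : Algebra γ n V) {x y z w w′} →
  Scans A x w (inj₂ y) → Scans A y w′ z → Scans A x (w′ ++ w) z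
scans-trans A p []      = p
scans-trans A p (e ∷ q) = e ∷ scans-trans A p q

scans-sound : ∀ {γ n V} (A : Algebra γ n V) {u z} → Scans A (start A) u z → Scanned A z u
scans-sound A []      = partial-start A
scans-sound A (e ∷ p) = scan-sound A _ _ _ _ e (scans-sound A p)

-- No element is entered by `lbr`, which would close the surrounding list; the inner scan fails on
-- it as well.
scan-start : ∀ {γ n V W fin empty cons} (A : Algebra γ n W) l {z v b} → scan A l (start A) ≡ just z →
  scan {V = V} (node fin A empty cons) l (just (v , b , nothing)) ≡ just (resume cons v b z)
scan-start A (sym a) e rewrite e = refl
scan-start A rbr     e rewrite e = refl
scan-start (leaf _)       lbr ()
scan-start (node _ _ _ _) lbr ()

scan-inside : ∀ {γ n V W fin empty cons} (A : Algebra γ n W) l {x z v b} → scan A l x ≡ just z →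
  scan {V = V} (node fin A empty cons) l (just (v , b , just x)) ≡ just (resume cons v b z)
scan-inside A (sym a) e rewrite e = refl
scan-inside A rbr     e rewrite e = refl
scan-inside A lbr     e rewrite e = refl

scans-inside : ∀ {γ n V W fin empty cons} (A : Algebra γ n W) {l w z v b} → Scans A (start A) (l ∷ w) z →
  Scans {V = V} (node fin A empty cons) (just (v , b , nothing)) (l ∷ w) (resume cons v b z)
scans-inside A (e ∷ [])         = scan-start A _ e ∷ []
scans-inside A (e ∷ p@(_ ∷ _)) = scan-inside A _ e ∷ scans-inside A p

-- The state between elements differs from the state at the start of an element, so `scans-inside`
-- needs at least one letter.
spell-nonempty : ∀ {γ} n (s : Nested γ n) → ∃[ l ] ∃[ w ] (spell n s ≡ l ∷ w)
spell-nonempty zero    a = _ , _ , refl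
spell-nonempty (suc n) s = _ , _ , refl

scans-complete : ∀ {γ n V} (A : Algebra γ n V) s → Proper n s → Scans A (start A) (spell n s) (inj₁ (eval A s))
scans-complete (leaf f) a _ = refl ∷ []
scans-complete {γ} {suc n} B@(node fin A empty cons) s (ad , ps) = closing ad ∷ body s ps
  where
  closing : ∀ {b} → b ≡ true → scan B lbr (just (eval B s , b , nothing)) ≡ just (inj₁ (eval B s))
  closing refl = refl
  body : ∀ r → All (Proper n) r →
    Scans B (start B) (spells n r) (inj₂ (just (eval B r , admissible n r , nothing)))
  body []      []       = refl ∷ []
  body (t ∷ r) (p ∷ ps) = scans-trans B (body r ps) element
    where
    element : Scans B (just (eval B r , admissible n r , nothing)) (spell n t)
                      (inj₂ (just (eval B (t ∷ r) , true , nothing)))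
    element with spell n t | spell-nonempty n t | scans-complete A t p
    ... | _ | _ , _ , refl | q = scans-inside A q

scan-finite : ∀ {γ n V} (A : Algebra γ n V) → Finite V → Finite (Scan A)
scan-finite (leaf _)         fin = ⊤-finite
scan-finite (node fin A _ _) fin′ =
  maybe-finite (fin′ ×-finite bool-finite ×-finite maybe-finite (scan-finite A fin))

module _ {γ n V} (fin : Finite V) (A : Algebra γ n V) {Accept : V → Set} (accept? : ∀ v → Dec (Accept v)) where

  states : Finite (V ⊎ Scan A)
  states = fin ⊎-finite scan-finite A fin

  -- An `NFA` reads from left to right, so its transitions are those of the scan reversed: it
  -- guesses an accepted final value and traces the scan back to its start.
  Step : Letter γ → V ⊎ Scan A → V ⊎ Scan A → Set
  Step l z z′ = ∃[ x ] (z′ ≡ inj₂ x × scan A l x ≡ just z)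

  step? : ∀ l z z′ → Dec (Step l z z′)
  step? l z (inj₁ _) = no λ { (_ , () , _) }
  step? l z (inj₂ x) with ≡-dec (≟-finite states) (scan A l x) (just z)
  ... | yes e = yes (x , refl , e)
  ... | no ¬e = no λ { (_ , refl , e) → ¬e e }

  Initial : V ⊎ Scan A → Set
  Initial z = ∃[ v ] (z ≡ inj₁ v × Accept v)

  initial? : ∀ z → Dec (Initial z)
  initial? (inj₁ v) with accept? v
  ... | yes a = yes (v , refl , a)
  ... | no ¬a = no λ { (_ , refl , a) → ¬a a }
  initial? (inj₂ _) = no λ { (_ , () , _) }

  final? : ∀ z → Dec (z ≡ inj₂ (start A))
  final? z = ≟-finite states z (inj₂ (start A))

  automaton : NFA (Letter γ)
  automaton = record
    { size    = proj₁ states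
    ; initial = comprehension states initial?
    ; final   = comprehension states final?
    ; δ       = λ q l → comprehension states (step? l (dec states q))
    }

  open NFA automaton using (AcceptsFrom; Accepts; stop; step)

  accepts⇒scans : ∀ {q u} → AcceptsFrom q u → ∀ z → enc states z ≡ q → Scans A (start A) u z
  accepts⇒scans (stop f) z refl with ∈-comprehension⁻ states final? {z} f
  ... | refl = []
  accepts⇒scans (step {q′} {l} m p) z refl
    with ∈-comprehension-dec⁻ states (step? l (dec states (enc states z))) q′ m
  ... | x , eq , e = trans e (cong just (dec-enc states z)) ∷
    accepts⇒scans p (inj₂ x) (trans (cong (enc states) (≡.sym eq)) (enc-dec states q′))

  scans⇒accepts : ∀ {u z} → Scans A (start A) u z → AcceptsFrom (enc states z) u
  scans⇒accepts []                = stop (∈-comprehension⁺ states final? refl)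
  scans⇒accepts (_∷_ {l} {y = y} {z} e p) = step
    (∈-comprehension⁺ states (step? l _) (y , refl , trans e (cong just (≡.sym (dec-enc states z)))))
    (scans⇒accepts p)

  automaton-correct : ∀ u → Accepts u ⇔ (∃[ s ] (Proper n s × Accept (eval A s) × spell n s ≡ u))
  automaton-correct u = mk⇔ sound complete
    where
    sound : Accepts u → _
    sound (q , i , p)
      with ∈-comprehension-dec⁻ states initial? q i
    ... | v , eq , a
      with scans-sound A (accepts⇒scans p (inj₁ v) (trans (cong (enc states) (≡.sym eq)) (enc-dec states q)))
    ... | s , ps , refl , e = s , ps , a , e
    complete : _ → Accepts u
    complete (s , ps , a , refl) =
      _ , ∈-comprehension⁺ states initial? (_ , refl , a) , scans⇒accepts (scans-complete A s ps)

-- Stores as nested lists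

embed : ∀ {γ n} → Store γ n → Nested γ n
embed (store₁ as)                         = as
embed {n = suc (suc n)} (storeₙ (s ∷ ss)) = embed s ∷ List.map (embed {n = suc n}) ss

spells-letters : ∀ {γ} (as : List (Fin γ)) → spells zero as ≡ List.map sym as ∷ʳ rbr
spells-letters []       = refl
spells-letters (a ∷ as) = cong (sym a ∷_) (spells-letters as)

spell-embed : ∀ {γ n} (s : Store γ n) → spell n (embed s) ≡ word s
spells-embed : ∀ {γ n} (ss : List (Store γ (suc n))) →
  spells (suc n) (List.map embed ss) ≡ concatMap word ss ∷ʳ rbr

spell-embed (store₁ as)       = cong (lbr ∷_) (spells-letters as)
spell-embed {n = suc (suc n)} (storeₙ (s ∷ ss)) = cong (lbr ∷_)
  (trans (cong₂ _++_ (spell-embed {n = suc n} s) (spells-embed {n = n} ss))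
         (≡.sym (++-assoc (word s) (concatMap word ss) (rbr ∷ []))))

spells-embed []       = refl
spells-embed (s ∷ ss) =
  trans (cong₂ _++_ (spell-embed s) (spells-embed ss)) (≡.sym (++-assoc (word s) (concatMap word ss) (rbr ∷ [])))

-- The trailing words let the induction peel off one element at a time; a list ends where `rbr`
-- stands, since no element begins with it.
spell-prefix-free : ∀ {γ} n (s t : Nested γ n) {u v} → spell n s ++ u ≡ spell n t ++ v → s ≡ t × u ≡ v
spells-prefix-free : ∀ {γ} n (s t : List (Nested γ n)) {u v} → spells n s ++ u ≡ spells n t ++ v → s ≡ t × u ≡ v
rbr≢spell : ∀ {γ} n (t : Nested γ n) {u v w} → rbr ∷ u ≢ (spell n t ++ v) ++ w

rbr≢spell zero    t ()
rbr≢spell (suc n) t ()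

spell-prefix-free zero    a b refl = refl , refl
spell-prefix-free (suc n) s t e    = spells-prefix-free n s t (∷-injectiveʳ e)

spells-prefix-free n []      []       refl = refl , refl
spells-prefix-free n []      (t ∷ ts) e    = contradiction e (rbr≢spell n t)
spells-prefix-free n (s ∷ r) []       e    = contradiction (≡.sym e) (rbr≢spell n s)
spells-prefix-free n (s ∷ ss) (t ∷ ts) e
  with spell-prefix-free n s t (trans (≡.sym (++-assoc (spell n s) _ _)) (trans e (++-assoc (spell n t) _ _)))
... | refl , e′ = map₁ (cong (s ∷_)) (spells-prefix-free n ss ts e′)

spell-injective : ∀ {γ} n {s t : Nested γ n} → spell n s ≡ spell n t → s ≡ t
spell-injective n {s} {t} e = proj₁ (spell-prefix-free n s t (cong (_++ []) e))

embed-injective : ∀ {γ n} (s t : Store γ n) → embed s ≡ embed t → s ≡ t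
embeds-injective : ∀ {γ n} (ss ts : List (Store γ (suc n))) → List.map embed ss ≡ List.map embed ts → ss ≡ ts

embed-injective (store₁ as) (store₁ bs) e = cong store₁ e
embed-injective {n = suc (suc n)} (storeₙ (s ∷ ss)) (storeₙ (t ∷ ts)) e = cong₂ (λ s ss → storeₙ (s ∷ ss))
  (embed-injective {n = suc n} s t (∷-injectiveˡ e)) (embeds-injective {n = n} ss ts (∷-injectiveʳ e))

embeds-injective []       []       e = refl
embeds-injective (s ∷ ss) (t ∷ ts) e =
  cong₂ _∷_ (embed-injective s t (∷-injectiveˡ e)) (embeds-injective ss ts (∷-injectiveʳ e))

embed-proper : ∀ {γ n} (s : Store γ (suc n)) → Proper (suc n) (embed s)
embeds-proper : ∀ {γ n} (ss : List (Store γ (suc n))) → All (Proper (suc n)) (List.map embed ss)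

embed-proper (store₁ as) = admissible-letters as , letters-proper as
  where
  admissible-letters : ∀ {γ} (as : List (Fin γ)) → admissible zero as ≡ true
  admissible-letters []      = refl
  admissible-letters (_ ∷ _) = refl
  letters-proper : ∀ {γ} (as : List (Fin γ)) → All (Proper zero) as
  letters-proper []       = []
  letters-proper (a ∷ as) = tt ∷ letters-proper as
embed-proper {n = suc n} (storeₙ (s ∷ ss)) = refl , embed-proper s ∷ embeds-proper ss

embeds-proper []       = []
embeds-proper (s ∷ ss) = embed-proper s ∷ embeds-proper ss

unembed : ∀ {γ} n (s : Nested γ (suc n)) → Proper (suc n) s → ∃[ t ] (embed t ≡ s)
unembeds : ∀ {γ} n (s : List (Nested γ (suc n))) → All (Proper (suc n)) s →
  ∃[ ts ] (List.map (embed {γ} {suc n}) ts ≡ s)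

unembed zero    as      _            = store₁ as , refl
unembed (suc n) (s ∷ r) (_ , p ∷ ps) with unembed n s p | unembeds n r ps
... | t , refl | ts , refl = storeₙ (t ∷ ts) , refl

unembeds n []      []       = [] , refl
unembeds n (s ∷ r) (p ∷ ps) with unembed n s p | unembeds n r ps
... | t , refl | ts , refl = t ∷ ts , refl

-- Store operations as operations on nested lists

topLetter : ∀ {γ} n → Top γ n → Maybe (Fin γ)
topLetter zero    a        = just a
topLetter (suc n) nothing  = nothing
topLetter (suc n) (just i) = topLetter n i

topLetter-embed : ∀ {γ n} (s : Store γ n) → topLetter n (top n (embed s)) ≡ top₁ s
topLetter-embed (store₁ [])       = refl
topLetter-embed (store₁ (_ ∷ _))  = refl
topLetter-embed (storeₙ (s ∷ ss)) = topLetter-embed s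

-- The identity on stores with top letter a.
identity : ∀ {γ} → Fin γ → ∀ n → Nested γ n
identity a zero    = a
identity a (suc n) = identity a n ∷ []

-- A singleton code replaces the top element by one element, so nested singletons reach the topmost
-- list of order `k` and leave the rest alone.
lift : ∀ {γ k n} → k ≤′ n → Nested γ k → Nested γ n
lift ≤′-refl      o = o
lift (≤′-step le) o = lift le o ∷ []

-- A letter is its own overwriting code, so at order 1 the word `w` codes its own push.
rewriting : ∀ {γ} n → List (Fin γ) → Nested γ (suc n)
rewriting zero    w = w
rewriting (suc n) w = rewriting n w ∷ []

-- Faithful on stores with top letter a only.
code : ∀ {γ n} → Fin γ → Op γ (suc n) → Nested γ (suc n)
code {n = n} a (push₁ w)                      = rewriting n w
code a (push {suc (suc k)} (s≤s (s≤s _)) k≤n) = lift k≤n (identity a (suc k) ∷ identity a (suc k) ∷ [])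
code a (pop (s≤s (s≤s _)) k≤n)                = lift k≤n []

act-identity : ∀ {γ a} n (s : Nested γ n) → topLetter n (top n s) ≡ just a → act n (identity a n) s ≡ s
act-identity zero    a       e = ≡.sym (just-injective e)
act-identity (suc n) (t ∷ r) e = cong (_∷ r) (act-identity n t e)

-- x is the image of the store m, and lies outside the image of embed if m is nothing.
Tracks : ∀ {γ n} → Maybe (Store γ n) → Nested γ n → Set
Tracks m x = ∀ s → m ≡ just s ⇔ embed s ≡ x

tracks-just : ∀ {γ n} {s : Store γ n} → Tracks (just s) (embed s)
tracks-just {s = s} t = mk⇔ (λ { refl → refl }) (cong just ∘ ≡.sym ∘ embed-injective t s)

tracks-∷ : ∀ {γ n} {m : Maybe (Store γ (suc n))} {x} ss → Tracks m x →
  Tracks (Maybe.map (λ s → storeₙ (s ∷ ss)) m) (x ∷ List.map embed ss)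
tracks-∷ {n = n} {m} {x} ss tr (storeₙ (t ∷ ts)) = mk⇔ (to m tr) from
  where
  to : ∀ m → Tracks m x → Maybe.map (λ s → storeₙ (s ∷ ss)) m ≡ just (storeₙ (t ∷ ts)) →
    embed {n = suc n} t ∷ List.map embed ts ≡ x ∷ List.map embed ss
  to (just _) tr refl = cong (_∷ List.map embed ss) (Equivalence.to (tr t) refl)
  from : embed {n = suc n} t ∷ List.map embed ts ≡ x ∷ List.map embed ss →
    Maybe.map (λ s → storeₙ (s ∷ ss)) m ≡ just (storeₙ (t ∷ ts))
  from e rewrite Equivalence.from (tr t) (∷-injectiveˡ e) | embeds-injective ts ss (∷-injectiveʳ e) = refl

tracks-lift : ∀ {γ k n a f} {o : Nested γ (suc k)} (k≤n : suc k ≤′ n) →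
  (∀ s → top₁ s ≡ just a → Tracks (f s) (act (suc k) o (embed s))) →
  ∀ s → top₁ s ≡ just a → Tracks (atLevel k≤n f s) (act n (lift k≤n o) (embed s))
tracks-lift ≤′-refl       tr s                 e = tr s e
tracks-lift (≤′-step k≤n) tr (storeₙ (s ∷ ss)) e = tracks-∷ ss (tracks-lift k≤n tr s e)
tracks-lift (≤′-step (≤′-reflexive ())) tr (store₁ _) e

tracks-rewriteTop : ∀ {γ n a} w (s : Store γ (suc n)) → top₁ s ≡ just a →
  Tracks (rewriteTop w s) (act (suc n) (rewriting n w) (embed s))
tracks-rewriteTop w (store₁ (_ ∷ as)) _ rewrite map-id w = tracks-just
tracks-rewriteTop w (storeₙ (s ∷ ss)) e = tracks-∷ ss (tracks-rewriteTop w s e)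

tracks-duplicateTop : ∀ {γ n a} (s : Store γ (suc (suc n))) → top₁ s ≡ just a →
  Tracks (duplicateTop s) (act (suc (suc n)) (identity a (suc n) ∷ identity a (suc n) ∷ []) (embed s))
tracks-duplicateTop {n = n} (storeₙ (s ∷ _)) e
  rewrite act-identity (suc n) (embed s) (trans (topLetter-embed s) e) = tracks-just

-- Popping the only element leaves `[]`, which at these orders is the image of no store; this agrees
-- with `removeTop` being undefined.
tracks-removeTop : ∀ {γ n} (s : Store γ (suc (suc n))) → Tracks (removeTop s) (act (suc (suc n)) [] (embed s))
tracks-removeTop (storeₙ (_ ∷ []))    (storeₙ _) = mk⇔ (λ ()) (λ ())
tracks-removeTop (storeₙ (_ ∷ _ ∷ _)) = tracks-just

tracks-apply : ∀ {γ n a} (o : Op γ (suc n)) (s : Store γ (suc n)) → top₁ s ≡ just a →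
  Tracks (apply o s) (act (suc n) (code a o) (embed s))
tracks-apply (push₁ w) s e = tracks-rewriteTop w s e
tracks-apply (push {suc (suc k)} (s≤s (s≤s _)) k≤n) s e = tracks-lift k≤n tracks-duplicateTop s e
tracks-apply (pop {suc (suc k)} (s≤s (s≤s _)) k≤n) s e = tracks-lift k≤n (λ s _ → tracks-removeTop s) s e

-- Reading words by popping

-- What is left of the word of s once the opening brackets of its d outermost levels have been read.
remainder : ∀ {γ} n → Fin (suc n) → Nested γ n → List (Letter γ)
remainder n       zero    s       = spell n s
remainder (suc n) (suc d) []      = rbr ∷ []
remainder (suc n) (suc d) (t ∷ r) = remainder n d t ++ spells n r

after : ∀ {γ} n → Maybe (Nested γ n × Fin (suc n)) → Nested γ n → List (Letter γ)
after n nothing        s = []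
after n (just (o , d)) s = remainder n d (act n o s)

-- When the top element is used up it is popped, and reading goes on at depth 1, because the opening
-- bracket of the list has been read already.
outward : ∀ {γ} n → Maybe (Nested γ n × Fin (suc n)) → Nested γ (suc n) × Fin (suc (suc n))
outward n nothing        = [] , suc zero
outward n (just (o , d)) = o ∷ [] , suc d

-- The first few letters of a remainder, and the operation and the depth that lead to the remainder following
-- them; nothing means that no letter follows.
consume : ∀ {γ} n → Top γ n → Fin (suc n) → List (Letter γ) × Maybe (Nested γ n × Fin (suc n))
consume zero    a        zero    = sym a ∷ [] , nothing
consume (suc n) nothing  zero    = lbr ∷ rbr ∷ [] , nothing
consume (suc n) nothing  (suc d) = rbr ∷ [] , nothing
consume (suc n) (just i) zero    = let v , c = consume n i zero in lbr ∷ v , just (outward n c)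
consume (suc n) (just i) (suc d) = let v , c = consume n i d in v , just (outward n c)

after-outward : ∀ {γ} n c (t : Nested γ n) r →
  after n c t ++ spells n r ≡ after (suc n) (just (outward n c)) (t ∷ r)
after-outward n nothing        t []      = refl
after-outward n nothing        t (_ ∷ _) = refl
after-outward n (just (o , d)) t r       = refl

consume-remainder : ∀ {γ} n d (s : Nested γ n) → let v , c = consume n (top n s) d in
  remainder n d s ≡ v ++ after n c s
consume-element : ∀ {γ} n d (t : Nested γ n) r → let v , c = consume n (top n t) d in
  remainder n d t ++ spells n r ≡ v ++ after (suc n) (just (outward n c)) (t ∷ r)

consume-remainder zero    zero    a       = refl
consume-remainder (suc n) zero    []      = refl
consume-remainder (suc n) (suc d) []      = refl
consume-remainder (suc n) zero    (t ∷ r) = cong (lbr ∷_) (consume-element n zero t r)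
consume-remainder (suc n) (suc d) (t ∷ r) = consume-element n d t r

consume-element n d t r = let v , c = consume n (top n t) d in
  trans (cong (_++ spells n r) (consume-remainder n d t))
        (trans (++-assoc v _ _) (cong (v ++_) (after-outward n c t r)))

consume-nonempty : ∀ {γ} n (i : Top γ n) d → ∃[ l ] ∃[ v ] (proj₁ (consume n i d) ≡ l ∷ v)
consume-nonempty zero    a        zero    = _ , _ , refl
consume-nonempty (suc n) nothing  zero    = _ , _ , refl
consume-nonempty (suc n) nothing  (suc d) = _ , _ , refl
consume-nonempty (suc n) (just i) zero    = _ , _ , refl
consume-nonempty (suc n) (just i) (suc d) = consume-nonempty n i d

-- At least one letter is consumed. This is the termination measure for reading, since `act` need
-- not give a structurally smaller list.
after-shorter : ∀ {γ} n d (s : Nested γ n) →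
  length (after n (proj₂ (consume n (top n s) d)) s) < length (remainder n d s)
after-shorter n d s rewrite consume-remainder n d s with consume n (top n s) d | consume-nonempty n (top n s) d
... | _ , c | l , v , refl rewrite length-++ v {after n c s} = s≤s (m≤n+m _ (length v))

module Reading {L : Set} (A : NFA L) where
  open NFA A

  -- In continuation form, so that `K` can be acceptance of the remaining word as well as a
  -- predicate derived by a system.
  Reads : Fin size → List L → (Fin size → Set) → Set
  Reads q []      K = K q
  Reads q (l ∷ v) K = ∃[ q′ ] (q′ ∈ δ q l × Reads q′ v K)

  reads-mono : ∀ {K L} → (∀ q → K q → L q) → ∀ {q} v → Reads q v K → Reads q v L
  reads-mono K⊆L []      k            = K⊆L _ k
  reads-mono K⊆L (l ∷ v) (q′ , m , r) = q′ , m , reads-mono K⊆L v r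

  reads? : ∀ {K} → (∀ q → Dec (K q)) → ∀ q v → Dec (Reads q v K)
  reads? K? q []      = K? q
  reads? K? q (l ∷ v) = any? λ q′ → (q′ ∈? δ q l) ×-dec reads? K? q′ v

  reads⇒accepts : ∀ {q u} v → Reads q v (λ q′ → AcceptsFrom q′ u) → AcceptsFrom q (v ++ u)
  reads⇒accepts []      a            = a
  reads⇒accepts (l ∷ v) (q′ , m , r) = step m (reads⇒accepts v r)

  accepts⇒reads : ∀ {q u} v → AcceptsFrom q (v ++ u) → Reads q v (λ q′ → AcceptsFrom q′ u)
  accepts⇒reads []      a          = a
  accepts⇒reads (l ∷ v) (step m a) = _ , m , accepts⇒reads v a

module Reader {γ n : ℕ} (A : NFA (Letter γ)) where
  open NFA A
  open Reading A

  -- (q , d) says of s that A accepts its remainder at depth d from q.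
  Control : Set
  Control = Fin size × Fin (suc n)

  Resume : Maybe (Nested γ n × Fin (suc n)) → (Nested γ n → Control → Set) → Fin size → Set
  Resume nothing        D q = q ∈ final
  Resume (just (o , d)) D q = D o (q , d)

  Read : Top γ n → (Nested γ n → Control → Set) → Control → Set
  Read i D (q , d) = let v , c = consume n i d in Reads q v (Resume c D)

  resume-mono : ∀ {D E} → (∀ o x → D o x → E o x) → ∀ c q → Resume c D q → Resume c E q
  resume-mono D⊆E nothing        q f = f
  resume-mono D⊆E (just (o , d)) q x = D⊆E o _ x

  read-mono : ∀ i {D E} → (∀ o x → D o x → E o x) → ∀ x → Read i D x → Read i E x
  read-mono i D⊆E (q , d) = let v , c = consume n i d in reads-mono (resume-mono D⊆E c) v

  resume? : ∀ {D} → (∀ o x → Dec (D o x)) → ∀ c q → Dec (Resume c D q)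
  resume? D? nothing        q = q ∈? final
  resume? D? (just (o , d)) q = D? o _

  read? : ∀ i {D} → (∀ o x → Dec (D o x)) → ∀ x → Dec (Read i D x)
  read? i D? (q , d) = let v , c = consume n i d in reads? (resume? D? c) q v

  Started : (Control → Set) → Set
  Started K = ∃[ q ] (q ∈ initial × K (q , zero))

  started? : ∀ {K} → (∀ x → Dec (K x)) → Dec (Started K)
  started? K? = any? λ q → (q ∈? initial) ×-dec K? _

  Remaining : Nested γ n → Control → Set
  Remaining s (q , d) = AcceptsFrom q (remainder n d s)

  read-sound : ∀ s x → Read (top n s) (λ o → Remaining (act n o s)) x → Remaining s x
  read-sound s (q , d) r rewrite consume-remainder n d s with consume n (top n s) d
  ... | v , nothing      = reads⇒accepts v (reads-mono (λ _ → stop) v r)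
  ... | v , just (o , e) = reads⇒accepts v r

  read-unfold : ∀ s x → Remaining s x → Read (top n s) (λ o → Remaining (act n o s)) x
  read-unfold s (q , d) a = let v , c = consume n (top n s) d in
    reads-mono (resumed c) v (accepts⇒reads v (subst (AcceptsFrom q) (consume-remainder n d s) a))
    where
    resumed : ∀ c q → AcceptsFrom q (after n c s) → Resume c (λ o → Remaining (act n o s)) q
    resumed nothing        q (stop f) = f
    resumed (just (o , e)) q a        = a

  -- Induction on the length of the remainder. With the least model as `Z`, every acceptance becomes
  -- derivable.
  read-complete : ∀ {Z : Nested γ n → Control → Set} →
    (∀ s x → Read (top n s) (λ o → Z (act n o s)) x → Z s x) → ∀ s x → Remaining s x → Z s x
  read-complete {Z} closed s (q , d) = go (length (remainder n d s)) s q d ≤-refl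
    where
    go : ∀ k s q d → length (remainder n d s) ≤ k → Remaining s (q , d) → Z s (q , d)
    resumed : ∀ k s c → length (after n c s) < k → ∀ q → AcceptsFrom q (after n c s) →
      Resume c (λ o → Z (act n o s)) q
    go zero    s q d b a with ≤-trans (after-shorter n d s) b
    ... | ()
    go (suc k) s q d b a = closed s (q , d) (let v , c = consume n (top n s) d in
      reads-mono (resumed (suc k) s c (≤-trans (after-shorter n d s) b)) v
        (accepts⇒reads v (subst (AcceptsFrom q) (consume-remainder n d s) a)))
    resumed (suc k) s nothing        b q (stop f) = f
    resumed (suc k) s (just (o , e)) b q a        = go k (act n o s) q e (≤-pred b) a

-- The connectives

-- The semantics of `E[_U_]` with predicates in place of formulas.
Until : ∀ {γ n} → HCFP γ n → (Φ Ψ : Store γ n → Set) → Store γ n → Set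
Until {γ} {n} H Φ Ψ s =
  Σ[ m ∈ ℕ ] Σ[ σ ∈ (Fin (suc m) → Store γ n) ]
    ( σ zero ≡ s
    × (∀ (i : Fin m) → H ⊢ σ (inject₁ i) ↪ σ (suc i))
    × Ψ (σ (fromℕ m))
    × (∀ (i : Fin m) → Φ (σ (inject₁ i))) )

until-now : ∀ {γ n} {H : HCFP γ n} {Φ Ψ s} → Ψ s → Until H Φ Ψ s
until-now {s = s} ψ = 0 , (λ _ → s) , refl , (λ ()) , ψ , λ ()

until-step : ∀ {γ n} {H : HCFP γ n} {Φ Ψ s t} → Φ s → H ⊢ s ↪ t → Until H Φ Ψ t → Until H Φ Ψ s
until-step {γ} {n} {H} {Φ} {s = s} φ s↪t (m , σ , refl , steps , ψ , φs) = suc m , σ′ , refl , steps′ , ψ , φs′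
  where
  σ′ : Fin (suc (suc m)) → Store γ n
  σ′ zero    = s
  σ′ (suc i) = σ i
  steps′ : ∀ i → H ⊢ σ′ (inject₁ i) ↪ σ′ (suc i)
  steps′ zero    = s↪t
  steps′ (suc i) = steps i
  φs′ : ∀ i → Φ (σ′ (inject₁ i))
  φs′ zero    = φ
  φs′ (suc i) = φs i

-- Induction on the length of the path, peeling off its first state; this matches `Until` with a
-- least model.
until-least : ∀ {γ n} {H : HCFP γ n} {Φ Ψ Z : Store γ n → Set} →
  (∀ s → Ψ s → Z s) → (∀ s t → Φ s → H ⊢ s ↪ t → Z t → Z s) → ∀ s → Until H Φ Ψ s → Z s
until-least {γ} {n} {H} {Φ} {Ψ} {Z} now later s (m , σ , refl , steps , ψ , φs) = go m σ steps ψ φs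
  where
  go : ∀ m (σ : Fin (suc m) → Store γ n) → (∀ (i : Fin m) → H ⊢ σ (inject₁ i) ↪ σ (suc i)) →
    Ψ (σ (fromℕ m)) → (∀ (i : Fin m) → Φ (σ (inject₁ i))) → Z (σ zero)
  go zero    σ steps ψ φs = now _ ψ
  go (suc m) σ steps ψ φs = later _ _ (φs zero) (steps zero) (go m (σ ∘ suc) (steps ∘ suc) ψ (φs ∘ suc))

-- Acceptance also certifies that `s` is the image of a store, which excludes the junk produced by
-- undefined operations.
accepts-spell : ∀ {γ n} {A : NFA (Letter γ)} {Φ : Store γ n → Set} → Recognises A Φ →
  ∀ s → NFA.Accepts A (spell n s) ⇔ (∃[ t ] (embed t ≡ s × Φ t))
accepts-spell {n = n} rec s = mk⇔
  (λ a → let t , e , φ = Equivalence.to (rec _) a in t , spell-injective n (trans (spell-embed t) e) , φ)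
  (λ { (t , refl , φ) → Equivalence.from (rec _) (t , ≡.sym (spell-embed t) , φ) })

accepts-embed : ∀ {γ n} {A : NFA (Letter γ)} {Φ : Store γ n → Set} → Recognises A Φ →
  ∀ t → NFA.Accepts A (spell n (embed t)) ⇔ Φ t
accepts-embed {Φ = Φ} rec t = mk⇔
  (λ a → let t′ , e , φ = Equivalence.to (accepts-spell rec (embed t)) a in subst Φ (embed-injective t′ t e) φ)
  (λ φ → Equivalence.from (accepts-spell rec (embed t)) (t , refl , φ))

recognises-resp : ∀ {γ n} {A : NFA (Letter γ)} {Φ Ψ : Store γ n → Set} →
  (∀ s → Φ s ⇔ Ψ s) → Recognises A Φ → Recognises A Ψ
recognises-resp Φ⇔Ψ rec u = mk⇔
  (λ a → let s , e , φ = Equivalence.to (rec u) a in s , e , Equivalence.to (Φ⇔Ψ s) φ)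
  (λ (s , e , ψ) → Equivalence.from (rec u) (s , e , Equivalence.from (Φ⇔Ψ s) ψ))

automaton-recognises : ∀ {γ n V} (fin : Finite V) (A : Algebra γ (suc n) V) {Accept : V → Set}
  (accept? : ∀ v → Dec (Accept v)) → Recognises {γ} {suc n} (automaton fin A accept?) (λ s → Accept (eval A (embed s)))
automaton-recognises {n = n} fin A {Accept} accept? u = mk⇔
  (λ a → to (Equivalence.to (automaton-correct fin A accept? u) a))
  (λ { (t , e , acc) → Equivalence.from (automaton-correct fin A accept? u)
         (embed t , embed-proper t , acc , trans (spell-embed t) e) })
  where
  to : (∃[ s ] (Proper (suc n) s × Accept (eval A s) × spell (suc n) s ≡ u)) →
    ∃[ t ] (word t ≡ u × Accept (eval A (embed t)))
  to (s , ps , acc , e) with unembed n s ps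
  ... | t , refl = t , trans (≡.sym (spell-embed t)) e , acc

-- A system for the connectives

module Query {γ n : ℕ} (H : HCFP γ (suc n)) (A B : NFA (Letter γ)) where
  open HCFP H
  module RA = Reader {γ} {suc n} A
  module RB = Reader {γ} {suc n} B

  -- One set of predicates serves all connectives. Negation and conjunction need only those that
  -- read words; the unary connectives take the same automaton twice.
  Predicate : Set
  Predicate = Bool ⊎ (RA.Control ⊎ RB.Control)

  pattern next     = inj₁ false
  pattern until    = inj₁ true
  pattern first x  = inj₂ (inj₁ x)
  pattern second x = inj₂ (inj₂ x)

  finite : Finite Predicate
  finite = bool-finite ⊎-finite (fin-finite ×-finite fin-finite) ⊎-finite (fin-finite ×-finite fin-finite)

  Successor : Top γ (suc n) → (Nested γ (suc n) → Set) → Set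
  Successor i D = Any (λ (a , o) → topLetter (suc n) i ≡ just a × D (code a o)) Δ

  successor? : ∀ i {D} → (∀ o → Dec (D o)) → Dec (Successor i D)
  successor? i D? = Any.any? (λ (a , o) → ≡-dec _≟_ (topLetter (suc n) i) (just a) ×-dec D? (code a o)) Δ

  Rule : Top γ (suc n) → (Nested γ (suc n) → Predicate → Set) → Predicate → Set
  Rule i D next       = Successor i (λ o → RA.Started (D o ∘ first))
  -- A rule cannot use predicates of `s` itself, so the first reading step of either automaton on
  -- `s` is inlined.
  Rule i D until      = RB.Started (RB.Read i (λ o → D o ∘ second))
                      ⊎ (RA.Started (RA.Read i (λ o → D o ∘ first)) × Successor i (λ o → D o until))
  Rule i D (first x)  = RA.Read i (λ o → D o ∘ first) x
  Rule i D (second x) = RB.Read i (λ o → D o ∘ second) x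

  mono : ∀ {i D E} → (∀ o p → D o p → E o p) → ∀ {p} → Rule i D p → Rule i E p
  mono {i} D⊆E {next} r = Any.map (λ { (e , q , m , d) → e , q , m , D⊆E _ _ d }) r
  mono {i} D⊆E {until} (inj₁ (q , m , r)) = inj₁ (q , m , RB.read-mono i (λ o x → D⊆E o _) (q , zero) r)
  mono {i} D⊆E {until} (inj₂ ((q , m , r) , s)) =
    inj₂ ((q , m , RA.read-mono i (λ o x → D⊆E o _) (q , zero) r) , Any.map (λ { (e , d) → e , D⊆E _ _ d }) s)
  mono {i} D⊆E {first x}  r = RA.read-mono i (λ o x → D⊆E o _) x r
  mono {i} D⊆E {second x} r = RB.read-mono i (λ o x → D⊆E o _) x r

  rule? : ∀ {i D} → (∀ o p → Dec (D o p)) → ∀ p → Dec (Rule i D p)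
  rule? {i} D? next       = successor? i (λ o → RA.started? (D? o ∘ first))
  rule? {i} D? until      = RB.started? (RB.read? i (λ o → D? o ∘ second))
    ⊎-dec (RA.started? (RA.read? i (λ o → D? o ∘ first)) ×-dec successor? i (λ o → D? o until))
  rule? {i} D? (first x)  = RA.read? i (λ o → D? o ∘ first) x
  rule? {i} D? (second x) = RB.read? i (λ o → D? o ∘ second) x

  system : System γ (suc n) Predicate
  system = record { Rule = Rule ; mono = mono ; rule? = rule? }

  True : Nested γ (suc n) → Predicate → Set
  True = Holds finite system

  module _ {Φ Ψ : Store γ (suc n) → Set} (recΦ : Recognises A Φ) (recΨ : Recognises B Ψ) where

    Meaning : Nested γ (suc n) → Predicate → Set
    -- Not claimed of improper s, which may have a proper successor.
    Meaning s next       = ∀ t → embed t ≡ s → ∃[ t′ ] ((H ⊢ t ↪ t′) × Φ t′)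
    Meaning s until      = ∃[ t ] (embed t ≡ s × Until H Φ Ψ t)
    Meaning s (first x)  = RA.Remaining s x
    Meaning s (second x) = RB.Remaining s x

    -- That some `t′` exists is not claimed, as the operation may be undefined on `t`; `D o` has to
    -- supply it.
    successor⇒step : ∀ {D} (t : Store γ (suc n)) → Successor (top (suc n) (embed t)) D →
      ∃[ o ] (D o × (∀ t′ → embed t′ ≡ act (suc n) o (embed t) → H ⊢ t ↪ t′))
    successor⇒step t σ with find σ
    ... | (a , o) , m , e , d =
      let e′ = trans (≡.sym (topLetter-embed t)) e in
      code a o , d , λ t′ eq → a , o , m , e′ , Equivalence.from (tracks-apply o t e′ t′) eq

    step⇒successor : ∀ {D : Nested γ (suc n) → Set} (t t′ : Store γ (suc n)) → H ⊢ t ↪ t′ →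
      (∀ o → act (suc n) o (embed t) ≡ embed t′ → D o) → Successor (top (suc n) (embed t)) D
    step⇒successor t t′ (a , o , m , e , ap) d =
      lose m (trans (topLetter-embed t) e , d (code a o) (≡.sym (Equivalence.to (tracks-apply o t e t′) ap)))

    meaning-closed : Closed system Meaning
    meaning-closed _ next σ t refl
      with successor⇒step {D = λ o → RA.Started (Meaning (act _ o (embed t)) ∘ first)} t σ
    ... | o , a , steps with Equivalence.to (accepts-spell recΦ _) a
    ... | t′ , e , φ = t′ , steps t′ e , φ
    meaning-closed s until (inj₁ (q , m , r))
      with Equivalence.to (accepts-spell recΨ s) (q , m , RB.read-sound s (q , zero) r)
    ... | t , e , ψ = t , e , until-now {H = H} {Φ} {Ψ} ψ
    meaning-closed s until (inj₂ ((q , m , r) , σ))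
      with Equivalence.to (accepts-spell recΦ s) (q , m , RA.read-sound s (q , zero) r)
    ... | t , refl , φ with successor⇒step {D = λ o → Meaning (act _ o (embed t)) until} t σ
    ... | o , (t′ , e′ , u) , steps = t , refl , until-step {H = H} {Φ} {Ψ} φ (steps t′ e′) u
    meaning-closed s (first x)  r = RA.read-sound s x r
    meaning-closed s (second x) r = RB.read-sound s x r

    true-closed : Closed system True
    true-closed = holds-closed (suc n) finite system

    true⇒meaning : ∀ s p → True s p → Meaning s p
    true⇒meaning = holds-least (suc n) finite system meaning-closed

    first-complete : ∀ s x → RA.Remaining s x → True s (first x)
    first-complete = RA.read-complete (λ s x → true-closed s (first x))

    second-complete : ∀ s x → RB.Remaining s x → True s (second x)
    second-complete = RB.read-complete (λ s x → true-closed s (second x))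

    first-correct : ∀ t → RA.Started (True (embed t) ∘ first) ⇔ Φ t
    first-correct t = mk⇔
      (λ (q , m , h) →
        Equivalence.to (accepts-embed recΦ t) (q , m , true⇒meaning (embed t) (first (q , zero)) h))
      (λ φ → let q , m , a = Equivalence.from (accepts-embed recΦ t) φ in
        q , m , first-complete (embed t) (q , zero) a)

    second-correct : ∀ t → RB.Started (True (embed t) ∘ second) ⇔ Ψ t
    second-correct t = mk⇔
      (λ (q , m , h) →
        Equivalence.to (accepts-embed recΨ t) (q , m , true⇒meaning (embed t) (second (q , zero)) h))
      (λ ψ → let q , m , a = Equivalence.from (accepts-embed recΨ t) ψ in
        q , m , second-complete (embed t) (q , zero) a)

    next-correct : ∀ t → True (embed t) next ⇔ (∃[ t′ ] ((H ⊢ t ↪ t′) × Φ t′))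
    next-correct t = mk⇔ (λ h → true⇒meaning (embed t) next h t refl)
      (λ (t′ , st , φ) → true-closed (embed t) next (step⇒successor t t′ st λ o e →
        subst (λ s → RA.Started (True s ∘ first)) (≡.sym e) (Equivalence.from (first-correct t′) φ)))

    -- One direction is leastness of the model, the other leastness of `Until` together with
    -- closedness of the model.
    until-correct : ∀ t → True (embed t) until ⇔ Until H Φ Ψ t
    until-correct t = mk⇔ to (until-least {H = H} {Φ} {Ψ} now later t)
      where
      to : True (embed t) until → Until H Φ Ψ t
      to h with true⇒meaning (embed t) until h
      ... | t′ , e , u = subst (Until H Φ Ψ) (embed-injective t′ t e) u
      now : ∀ s → Ψ s → True (embed s) until
      now s ψ with Equivalence.from (accepts-embed recΨ s) ψ
      -- Acceptance is unfolded by one reading step, to fit the inlined rule, and completeness of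
      -- reading is used after that step.
      ... | q , m , a = true-closed (embed s) until (inj₁ (q , m ,
        RB.read-mono (top _ (embed s)) (λ o → second-complete (act _ o (embed s))) (q , zero)
          (RB.read-unfold (embed s) (q , zero) a)))
      later : ∀ s s′ → Φ s → H ⊢ s ↪ s′ → True (embed s′) until → True (embed s) until
      later s s′ φ st h with Equivalence.from (accepts-embed recΦ s) φ
      ... | q , m , a = true-closed (embed s) until (inj₂
        ( (q , m , RA.read-mono (top _ (embed s)) (λ o → first-complete (act _ o (embed s))) (q , zero)
            (RA.read-unfold (embed s) (q , zero) a))
        , step⇒successor s s′ st (λ o e → subst (λ s → True s until) (≡.sym e) h) ))

  values : Algebra γ (suc n) (FiniteSubset finite)
  values = truth finite system

  -- Each store has exactly one value, so every connective is a choice of `Accept`. Only words of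
  -- stores are accepted, so complements are taken among stores.
  selector : {Accept : FiniteSubset finite → Set} → (∀ v → Dec (Accept v)) → NFA (Letter γ)
  selector = automaton (subset-finite _) values

  First Second : FiniteSubset finite → Set
  First  v = RA.Started (λ x → first x ∈⟨ finite ⟩ v)
  Second v = RB.Started (λ x → second x ∈⟨ finite ⟩ v)

  first? : ∀ v → Dec (First v)
  first? v = RA.started? (λ x → first x ∈⟨ finite ⟩? v)

  second? : ∀ v → Dec (Second v)
  second? v = RB.started? (λ x → second x ∈⟨ finite ⟩? v)

-- Compiling formulas to automata

compile : ∀ {γ n} → HCFP γ (suc n) → Formula γ (suc n) → NFA (Letter γ)
compile H (atom R)  = RegularSet.automaton R
compile H (neg φ)   = selector (λ v → ¬? (first? v))
  where open Query H (compile H φ) (compile H φ)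
compile H (φ and ψ) = selector (λ v → first? v ×-dec second? v)
  where open Query H (compile H φ) (compile H ψ)
compile H (EX φ)    = selector (next ∈⟨ finite ⟩?_)
  where open Query H (compile H φ) (compile H φ)
compile H E[ φ U ψ ] = selector (until ∈⟨ finite ⟩?_)
  where open Query H (compile H φ) (compile H ψ)

compile-correct : ∀ {γ n} (H : HCFP γ (suc n)) φ → Recognises (compile H φ) (λ s → H , s ⊨ φ)
compile-correct H (atom R) u = mk⇔
  (λ a → let s , e = RegularSet.onlyStores R u a in
    s , e , subst (NFA.Accepts (RegularSet.automaton R)) (≡.sym e) a)
  (λ { (s , refl , a) → a })
compile-correct H (neg φ) = recognises-resp
  (λ s → let fc = first-correct rec rec s in mk⇔ (_∘ Equivalence.from fc) (_∘ Equivalence.to fc))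
  (automaton-recognises (subset-finite _) values (λ v → ¬? (first? v)))
  where
  open Query H (compile H φ) (compile H φ)
  rec = compile-correct H φ
compile-correct H (φ and ψ) = recognises-resp
  (λ s → first-correct recφ recψ s ×-⇔ second-correct recφ recψ s)
  (automaton-recognises (subset-finite _) values (λ v → first? v ×-dec second? v))
  where
  open Query H (compile H φ) (compile H ψ)
  recφ = compile-correct H φ
  recψ = compile-correct H ψ
compile-correct H (EX φ) = recognises-resp (next-correct rec rec)
  (automaton-recognises (subset-finite _) values (next ∈⟨ finite ⟩?_))
  where
  open Query H (compile H φ) (compile H φ)
  rec = compile-correct H φ
compile-correct H E[ φ U ψ ] = recognises-resp (until-correct (compile-correct H φ) (compile-correct H ψ))
  (automaton-recognises (subset-finite _) values (until ∈⟨ finite ⟩?_))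
  where
  open Query H (compile H φ) (compile H ψ)

theorem4 : Σ[ compute ∈ (∀ (γ n : ℕ) → 1 ≤ n → HCFP γ n → Formula γ n → NFA (Letter γ)) ]
    (∀ (γ n : ℕ) (1≤n : 1 ≤ n) (H : HCFP γ n) (φ : Formula γ n) →
    Recognises {γ} {n} (compute γ n 1≤n H φ) (λ s → H , s ⊨ φ))
theorem4 = (λ { _ _ (s≤s _) → compile }) , (λ { _ _ (s≤s _) → compile-correct })
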